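{- Let $G$ be a nice $d$-degenerate graph with maximum degree $\Delta(G)$. Then $G$ is $(1, \Delta(G) + d + 1)$-weight choosable. Alternately, every nice graph $G$ is $(1, \Delta(G) + \mathrm{col}(G))$-weight choosable.
   Context: All graphs are finite, simple and loopless. A graph is nice if it has no connected component isomorphic to $K_2$. A graph is $d$-degenerate if every induced subgraph of it has a vertex of degree (in that subgraph) at most $d$. The degeneracy $\partial(G)$ is the smallest $d$ for which $G$ is $d$-degenerate, and $\mathrm{col}(G) = \partial(G)+1$ is the colouring number of $G$. A graph $G$ is $(k,l)$-weight choosable if for every assignment of a list $L_v$ of $k$ real numbers to each vertex $v$ and a list $L_e$ of $l$ real numbers to each edge $e$, there is a choice of weights $w(v)\in L_v$ and $w(e)\in L_e$ (for all $v \in V(G)$, $e\in E(G)$) such that the function $v\mapsto w(v)+\sum_{e\ni v} w(e)$ is a proper colouring of $V(G)$ (adjacent vertices get different values). -}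

module Defs where

open import Data.Fin using (Fin; zero; suc)
import Data.Fin.Properties as Fin
open import Data.Fin.Subset using (Subset; _∈_; _⊆_; ∣_∣; Nonempty; ⊤)
open import Data.Fin.Subset.Properties using (_∈?_; _⊆?_; anySubset?; nonempty?)
open import Data.List using (List; length; map; filter; foldr; allFin)
open import Data.List.Extrema.Nat using (max)
open import Data.List.Properties using (length-filter; length-tabulate)
open import Data.Nat as ℕ using (ℕ; zero; suc; z≤n; s≤s)
import Data.Nat.Properties as ℕ
open import Data.Product using (∃; ∃-syntax; _×_; _,_; proj₁; proj₂)
open import Data.Rational as ℚ using (ℚ; 0ℚ; ½)
import Data.Rational.Properties as ℚ
import Data.Rational.Solver as ℚ-Solver
open import Function.Base using (id; _∘_)
open import Function.Bundles using (_⇔_)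
open import Function.Definitions using (Injective)
open import Relation.Binary.Construct.Closure.ReflexiveTransitive using (Star)
open import Relation.Binary.PropositionalEquality
  using (_≡_; _≢_; refl; sym; trans; cong; subst)
open import Relation.Nullary using (¬_; Dec; yes; no; contradiction)
open import Relation.Nullary.Decidable using (_×-dec_; _→-dec_; ¬?; decidable-stable; map′)

------------------------------------------------------------------------
-- Real numbers: Cauchy sequences of rationals

private
  <⇒≱ : ∀ {p q} → p ℚ.< q → ¬ (q ℚ.≤ p)
  <⇒≱ p<q q≤p = ℚ.<-irrefl refl (ℚ.<-≤-trans p<q q≤p)

  half-pos : ∀ {ε} → 0ℚ ℚ.< ε → 0ℚ ℚ.< ½ ℚ.* ε
  half-pos {ε} 0<ε =
    subst (ℚ._< ½ ℚ.* ε) (ℚ.*-zeroʳ ½) (ℚ.*-monoʳ-<-pos ½ 0<ε)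

  half+half : ∀ ε → ½ ℚ.* ε ℚ.+ ½ ℚ.* ε ≡ ε
  half+half ε = trans (sym (ℚ.*-distribʳ-+ ε ½ ½)) (ℚ.*-identityˡ ε)

  dist : ℚ → ℚ → ℚ
  dist p q = ℚ.∣ p ℚ.- q ∣

  dist-sym : ∀ p q → dist p q ≡ dist q p
  dist-sym p q = trans (sym (ℚ.∣-p∣≡∣p∣ (p ℚ.- q))) (cong ℚ.∣_∣ eq)
    where
    open ℚ-Solver.+-*-Solver
    eq : ℚ.- (p ℚ.- q) ≡ q ℚ.- p
    eq = solve 2 (λ a b → :- (a :- b) := b :- a) refl p q

  dist-triangle : ∀ p q r → dist p r ℚ.≤ dist p q ℚ.+ dist q r
  dist-triangle p q r =
    subst (λ t → ℚ.∣ t ∣ ℚ.≤ dist p q ℚ.+ dist q r) eq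
      (ℚ.∣p+q∣≤∣p∣+∣q∣ (p ℚ.- q) (q ℚ.- r))
    where
    open ℚ-Solver.+-*-Solver
    eq : (p ℚ.- q) ℚ.+ (q ℚ.- r) ≡ p ℚ.- r
    eq = solve 3 (λ a b c → (a :- b) :+ (b :- c) := a :- c) refl p q r

  dist-+ : ∀ p q r s → dist (p ℚ.+ q) (r ℚ.+ s) ℚ.≤ dist p r ℚ.+ dist q s
  dist-+ p q r s =
    subst (λ t → ℚ.∣ t ∣ ℚ.≤ dist p r ℚ.+ dist q s) eq
      (ℚ.∣p+q∣≤∣p∣+∣q∣ (p ℚ.- r) (q ℚ.- s))
    where
    open ℚ-Solver.+-*-Solver
    eq : (p ℚ.- r) ℚ.+ (q ℚ.- s) ≡ (p ℚ.+ q) ℚ.- (r ℚ.+ s)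
    eq = solve 4 (λ a b c d → (a :- c) :+ (b :- d) := (a :+ b) :- (c :+ d)) refl p q r s

IsCauchy : (ℕ → ℚ) → Set
IsCauchy x = ∀ ε → 0ℚ ℚ.< ε →
  ∃[ N ] (∀ m n → N ℕ.≤ m → N ℕ.≤ n → ℚ.∣ x m ℚ.- x n ∣ ℚ.< ε)

record ℝ : Set where
  constructor mkℝ
  field
    seq    : ℕ → ℚ
    cauchy : IsCauchy seq

open ℝ public

infix 4 _≃_ _#_

_≃_ : ℝ → ℝ → Set
x ≃ y = ∀ ε → 0ℚ ℚ.< ε →
  ∃[ N ] (∀ n → N ℕ.≤ n → ℚ.∣ seq x n ℚ.- seq y n ∣ ℚ.< ε)

-- "Different" for real numbers is apartness, the positive form of ¬ (x ≃ y).
-- #⇒≄ and #-tight below relate the two; classically they coincide.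
_#_ : ℝ → ℝ → Set
x # y = ∃[ ε ] (0ℚ ℚ.< ε ×
  ∃[ N ] (∀ n → N ℕ.≤ n → ε ℚ.≤ ℚ.∣ seq x n ℚ.- seq y n ∣))

#⇒≄ : ∀ x y → x # y → ¬ (x ≃ y)
#⇒≄ x y (ε , 0<ε , N , far) x≃y =
  let (M , near) = x≃y ε 0<ε
  in <⇒≱ (near (N ℕ.⊔ M) (ℕ.m≤n⊔m N M)) (far (N ℕ.⊔ M) (ℕ.m≤m⊔n N M))

#-tight : ∀ x y → ¬ (x # y) → x ≃ y
#-tight x y ¬x#y ε 0<ε = go (dist (seq x N) (seq y N) ℚ.<? δ ℚ.+ δ)
  where
  δ η : ℚ
  δ = ½ ℚ.* (½ ℚ.* ε)
  η = ½ ℚ.* δ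
  0<δ : 0ℚ ℚ.< δ
  0<δ = half-pos (half-pos 0<ε)
  Nx = cauchy x η (half-pos 0<δ)
  Ny = cauchy y η (half-pos 0<δ)
  N = proj₁ Nx ℕ.⊔ proj₁ Ny
  Nx≤ = ℕ.m≤m⊔n (proj₁ Nx) (proj₁ Ny)
  Ny≤ = ℕ.m≤n⊔m (proj₁ Nx) (proj₁ Ny)

  drift : ∀ m n → N ℕ.≤ m → N ℕ.≤ n →
    dist (seq x m) (seq y m) ℚ.≤ dist (seq x n) (seq y n) ℚ.+ δ
  drift m n N≤m N≤n = begin
    dist xm ym                               ≤⟨ dist-triangle xm xn ym ⟩
    dist xm xn ℚ.+ dist xn ym                ≤⟨ ℚ.+-monoʳ-≤ (dist xm xn) (dist-triangle xn yn ym) ⟩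
    dist xm xn ℚ.+ (dist xn yn ℚ.+ dist yn ym)
      ≤⟨ ℚ.+-mono-≤ (ℚ.<⇒≤ (proj₂ Nx m n (ℕ.≤-trans Nx≤ N≤m) (ℕ.≤-trans Nx≤ N≤n)))
           (ℚ.+-monoʳ-≤ (dist xn yn)
             (ℚ.<⇒≤ (proj₂ Ny n m (ℕ.≤-trans Ny≤ N≤n) (ℕ.≤-trans Ny≤ N≤m)))) ⟩
    η ℚ.+ (dist xn yn ℚ.+ η)                 ≡⟨ solve 2 (λ a b → a :+ (b :+ a) := b :+ (a :+ a)) refl η (dist xn yn) ⟩
    dist xn yn ℚ.+ (η ℚ.+ η)                 ≡⟨ cong (dist xn yn ℚ.+_) (half+half δ) ⟩
    dist xn yn ℚ.+ δ                         ∎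
    where
    open ℚ.≤-Reasoning
    open ℚ-Solver.+-*-Solver using (solve; _:+_; _:=_)
    xm = seq x m
    xn = seq x n
    ym = seq y m
    yn = seq y n

  go : Dec (dist (seq x N) (seq y N) ℚ.< δ ℚ.+ δ) →
    ∃[ K ] (∀ n → K ℕ.≤ n → ℚ.∣ seq x n ℚ.- seq y n ∣ ℚ.< ε)
  go (yes near) = N , λ n N≤n → begin-strict
    dist (seq x n) (seq y n)           ≤⟨ drift n N N≤n ℕ.≤-refl ⟩
    dist (seq x N) (seq y N) ℚ.+ δ     <⟨ ℚ.+-monoˡ-< δ near ⟩
    (δ ℚ.+ δ) ℚ.+ δ                    ≡⟨ sym (ℚ.+-identityʳ _) ⟩
    ((δ ℚ.+ δ) ℚ.+ δ) ℚ.+ 0ℚ           <⟨ ℚ.+-monoʳ-< ((δ ℚ.+ δ) ℚ.+ δ) 0<δ ⟩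
    ((δ ℚ.+ δ) ℚ.+ δ) ℚ.+ δ            ≡⟨ ℚ.+-assoc (δ ℚ.+ δ) δ δ ⟩
    (δ ℚ.+ δ) ℚ.+ (δ ℚ.+ δ)            ≡⟨ cong (λ t → t ℚ.+ t) (half+half (½ ℚ.* ε)) ⟩
    ½ ℚ.* ε ℚ.+ ½ ℚ.* ε                ≡⟨ half+half ε ⟩
    ε                                  ∎
    where open ℚ.≤-Reasoning
  go (no ¬near) = contradiction
    (δ , 0<δ , N , λ n N≤n → cancel (dist (seq x n) (seq y n))
      (ℚ.≤-trans (ℚ.≮⇒≥ ¬near) (drift N n ℕ.≤-refl N≤n)))
    ¬x#y
    where
    cancel : ∀ t → δ ℚ.+ δ ℚ.≤ t ℚ.+ δ → δ ℚ.≤ t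
    cancel t le = ℚ.≮⇒≥ λ t<δ → <⇒≱ (ℚ.+-monoˡ-< δ t<δ) le

infixl 6 _+ℝ_

_+ℝ_ : ℝ → ℝ → ℝ
x +ℝ y = mkℝ (λ n → seq x n ℚ.+ seq y n) λ ε 0<ε →
  let (M , closeˣ) = cauchy x (½ ℚ.* ε) (half-pos 0<ε)
      (N , closeʸ) = cauchy y (½ ℚ.* ε) (half-pos 0<ε)
  in M ℕ.⊔ N , λ m n le₁ le₂ →
    ℚ.≤-<-trans (dist-+ (seq x m) (seq y m) (seq x n) (seq y n))
      (subst (dist (seq x m) (seq x n) ℚ.+ dist (seq y m) (seq y n) ℚ.<_) (half+half ε)
        (ℚ.+-mono-< (closeˣ m n (ℕ.m⊔n≤o⇒m≤o M N le₁) (ℕ.m⊔n≤o⇒m≤o M N le₂))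
                    (closeʸ m n (ℕ.m⊔n≤o⇒n≤o M N le₁) (ℕ.m⊔n≤o⇒n≤o M N le₂))))

0ℝ : ℝ
0ℝ = mkℝ (λ _ → 0ℚ) λ ε 0<ε → 0 , λ _ _ _ _ → 0<ε

sumℝ : List ℝ → ℝ
sumℝ = foldr _+ℝ_ 0ℝ

-- A list of k real numbers is a k-element set of reals, so its entries are
-- required to be pairwise different.
record RealList (k : ℕ) : Set where
  field
    entry    : Fin k → ℝ
    distinct : ∀ i j → i ≢ j → entry i # entry j

open RealList public

infix 4 _∈ᴸ_

_∈ᴸ_ : ∀ {k} → ℝ → RealList k → Set
x ∈ᴸ L = ∃[ i ] x ≃ entry L i

------------------------------------------------------------------------
-- Finite simple graphs

-- Edges are pairwise different two-element sets of vertices.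
record Graph : Set where
  field
    #V #E     : ℕ
    ends      : Fin #E → Subset #V
    ends-size : ∀ e → ∣ ends e ∣ ≡ 2
    ends-inj  : Injective _≡_ _≡_ ends

  V E : Set
  V = Fin #V
  E = Fin #E

  Adjacent : V → V → Set
  Adjacent u v = u ≢ v × ∃[ e ] (u ∈ ends e × v ∈ ends e)

  edgesAt : V → List E
  edgesAt v = filter (λ e → v ∈? ends e) (allFin #E)

  degree : V → ℕ
  degree v = length (edgesAt v)

  -- The edges of the subgraph induced by S are the edges contained in S.
  degreeIn : Subset #V → V → ℕ
  degreeIn S v =
    length (filter (λ e → (v ∈? ends e) ×-dec (ends e ⊆? S)) (allFin #E))

open Graph public using (#V; #E; ends; V; E)

-- For the graph without vertices this is 0.
Δ : Graph → ℕ
Δ G = max 0 (map (Graph.degree G) (allFin (#V G)))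

K₂ : Graph
K₂ = record
  { #V = 2
  ; #E = 1
  ; ends = λ _ → ⊤
  ; ends-size = λ _ → refl
  ; ends-inj = λ { {zero} {zero} _ → refl }
  }

IsComponent : (G : Graph) → Subset (#V G) → Set
IsComponent G C =
  ∃[ v ] (∀ u → u ∈ C ⇔ Star (Graph.Adjacent G) v u)

-- H is isomorphic to the subgraph of G induced by S.
record _≅_[_] (H G : Graph) (S : Subset (#V G)) : Set where
  field
    to        : V H → V G
    injective : Injective _≡_ _≡_ to
    image     : ∀ v → v ∈ S ⇔ (∃[ u ] to u ≡ v)
    adjacent  : ∀ u v → Graph.Adjacent H u v ⇔ Graph.Adjacent G (to u) (to v)

Nice : Graph → Set
Nice G = ¬ (∃[ C ] (IsComponent G C × K₂ ≅ G [ C ]))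

-- The empty set of vertices does not induce a subgraph with a vertex, so
-- induced subgraphs are taken to be nonempty.
Degenerate : ℕ → Graph → Set
Degenerate d G = ∀ (S : Subset (#V G)) → Nonempty S →
  ∃[ v ] (v ∈ S × Graph.degreeIn G S v ℕ.≤ d)

------------------------------------------------------------------------
-- Degeneracy and colouring number

IsLeast : (ℕ → Set) → ℕ → Set
IsLeast P m = P m × (∀ n → P n → m ℕ.≤ n)

least : ∀ {P : ℕ → Set} → (∀ n → Dec (P n)) → ∀ n → P n → ∃ (IsLeast P)
least P? n pn with P? 0
least P? n pn | yes p0 = 0 , p0 , λ _ _ → z≤n
least P? zero p0 | no ¬p0 = contradiction p0 ¬p0
least P? (suc n) pn | no ¬p0 =
  let (m , pm , m≤) = least (P? ∘ suc) n pn
  in suc m , pm , λ { zero p0 → contradiction p0 ¬p0 ; (suc k) pk → s≤s (m≤ k pk) }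

degenerate? : ∀ G d → Dec (Degenerate d G)
degenerate? G d = map′
  (λ none S → decidable-stable (good? S) λ bad → none (S , bad))
  (λ good (S , bad) → bad (good S))
  (¬? (anySubset? (¬? ∘ good?)))
  where
  good? : ∀ S → Dec (Nonempty S → ∃[ v ] (v ∈ S × Graph.degreeIn G S v ℕ.≤ d))
  good? S = nonempty? S →-dec
    Fin.any? (λ v → (v ∈? S) ×-dec (Graph.degreeIn G S v ℕ.≤? d))

#E-degenerate : ∀ G → Degenerate (#E G) G
#E-degenerate G S (v , v∈S) = v , v∈S ,
  ℕ.≤-trans (length-filter _ (allFin (#E G))) (ℕ.≤-reflexive (length-tabulate id))

leastDegenerate : ∀ G → ∃ (IsLeast (λ d → Degenerate d G))
leastDegenerate G = least (degenerate? G) (#E G) (#E-degenerate G)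

degeneracy : Graph → ℕ
degeneracy G = proj₁ (leastDegenerate G)

col : Graph → ℕ
col G = degeneracy G ℕ.+ 1

------------------------------------------------------------------------
-- Weight choosability

module _ (G : Graph) where

  total : (V G → ℝ) → (E G → ℝ) → V G → ℝ
  total wV wE v = wV v +ℝ sumℝ (map wE (Graph.edgesAt G v))

  ProperColouring : (V G → ℝ) → Set
  ProperColouring c = ∀ u v → Graph.Adjacent G u v → c u # c v

  WeightChoosable : ℕ → ℕ → Set
  WeightChoosable k l =
    (LV : V G → RealList k) (LE : E G → RealList l) →
    ∃[ wV ] ∃[ wE ]
      ((∀ v → wV v ∈ᴸ LV v) × (∀ e → wE e ∈ᴸ LE e) × ProperColouring (total wV wE))

{-# OPTIONS --safe #-}

-- The weights are chosen greedily.  For an edge xy, the difference of the totals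
-- at x and y does not involve the weight of xy; it is settled by the last weighted
-- edge adjacent to xy, and there is one because G is nice.  When the weight of an
-- edge e is chosen, each edge settled by e forbids at most one entry of the list
-- of e, so it suffices that every e settles at most Δ(G) + d edges.
--
-- Order the vertices so that each has at most d earlier neighbours, and weight each
-- edge at the time of its later end v.  Let e = uv be weighted at that time.  At
-- most Δ(G) of the edges settled by e contain u.  If v has a later neighbour, the
-- edge to it is still unweighted, so it is the only edge at v that e can settle;
-- otherwise v has degree at most d.

module Submission where

open import Defs
open import Data.Empty using (⊥-elim)
open import Data.Fin using (Fin; zero; suc; punchIn)
import Data.Fin.Properties as Fin
open import Data.Fin.Subset using (Subset; _∈_; _∉_; _⊆_; _⊂_; _-_; ∣_∣; ⊤; inside; outside)
open import Data.Fin.Subset.Induction using (⊂-wellFounded)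
open import Data.Fin.Subset.Properties
  using (_∈?_; _⊆?_; ∈⊤; ⊆-antisym; nonempty?; x∈p⇒p-x⊂p; x∈p∧x≢y⇒x∈p-y)
open import Data.List using (List; []; _∷_; _++_; [_]; length; map; filter; allFin)
open import Data.List.Extrema.Nat using (xs≤max)
open import Data.List.Membership.Propositional using (find; lose) renaming (_∈_ to _∈ˡ_; _∉_ to _∉ˡ_)
open import Data.List.Membership.Propositional.Properties
  using (∈-allFin; ∈-filter⁺; ∈-filter⁻; ∈-map⁺; ∈-++⁺ˡ; ∈-++⁺ʳ; ∈-length)
open import Data.List.Properties using (length-++; map-cong-local)
open import Data.List.Relation.Unary.All as All using (All; []; _∷_)
open import Data.List.Relation.Unary.Any as Any using (Any; here; there)
open import Data.List.Relation.Unary.AllPairs using ([]; _∷_)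
open import Data.List.Relation.Unary.Unique.Propositional using (Unique)
import Data.List.Relation.Unary.Any.Properties as Any
import Data.List.Relation.Unary.Unique.Propositional.Properties as Unique
open import Data.Nat as ℕ using (ℕ; zero; suc; _+_; s≤s)
import Data.Nat.Properties as ℕ
open import Data.Product using (∃-syntax; _×_; _,_; proj₁; proj₂)
open import Data.Rational as ℚ using (ℚ; 0ℚ; ½)
import Data.Rational.Properties as ℚ
import Data.Rational.Solver as ℚ-Solver
open import Data.Sum as Sum using (_⊎_; inj₁; inj₂)
open import Data.Vec using ([]; _∷_; here; there)
open import Data.Vec.Functional using (updateAt)
open import Data.Vec.Functional.Properties using (updateAt-updates; updateAt-minimal)
open import Function.Base using (_∘_; const)
open import Function.Bundles using (mk⇔)
open import Induction.WellFounded using (Acc; acc)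
open import Relation.Binary.Construct.Closure.ReflexiveTransitive using (Star; ε; _◅_)
open import Relation.Binary.PropositionalEquality
  using (_≡_; _≢_; refl; sym; trans; cong; cong₂; subst; subst₂; ≢-sym; module ≡-Reasoning)
open import Relation.Nullary using (¬_; Dec; yes; no; contradiction)
open import Relation.Nullary.Decidable using (_×-dec_; ¬?; decidable-stable)

-- Apartness of real numbers

½-pos : ∀ {p} → 0ℚ ℚ.< p → 0ℚ ℚ.< ½ ℚ.* p
½-pos {p} 0<p = subst (ℚ._< ½ ℚ.* p) (ℚ.*-zeroʳ ½) (ℚ.*-monoʳ-<-pos ½ 0<p)

½+½ : ∀ p → ½ ℚ.* p ℚ.+ ½ ℚ.* p ≡ p
½+½ p = trans (sym (ℚ.*-distribʳ-+ p ½ ½)) (ℚ.*-identityˡ p)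

∣-∣-sym : ∀ p q → ℚ.∣ p ℚ.- q ∣ ≡ ℚ.∣ q ℚ.- p ∣
∣-∣-sym p q = trans (sym (ℚ.∣-p∣≡∣p∣ (p ℚ.- q))) (cong ℚ.∣_∣ (eq p q))
  where
  open ℚ-Solver.+-*-Solver
  eq : ∀ p q → ℚ.- (p ℚ.- q) ≡ q ℚ.- p
  eq = solve 2 (λ a b → :- (a :- b) := b :- a) refl

∣-∣-triangle : ∀ p q r → ℚ.∣ p ℚ.- r ∣ ℚ.≤ ℚ.∣ p ℚ.- q ∣ ℚ.+ ℚ.∣ q ℚ.- r ∣
∣-∣-triangle p q r =
  subst (λ t → ℚ.∣ t ∣ ℚ.≤ ℚ.∣ p ℚ.- q ∣ ℚ.+ ℚ.∣ q ℚ.- r ∣) (eq p q r)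
    (ℚ.∣p+q∣≤∣p∣+∣q∣ (p ℚ.- q) (q ℚ.- r))
  where
  open ℚ-Solver.+-*-Solver
  eq : ∀ p q r → (p ℚ.- q) ℚ.+ (q ℚ.- r) ≡ p ℚ.- r
  eq = solve 3 (λ a b c → (a :- b) :+ (b :- c) := a :- c) refl

≃-refl : ∀ {x} → x ≃ x
≃-refl {x} δ 0<δ = 0 , λ n _ →
  subst (λ t → ℚ.∣ t ∣ ℚ.< δ) (sym (ℚ.+-inverseʳ (seq x n))) 0<δ

#-sym : ∀ x y → x # y → y # x
#-sym x y (δ , 0<δ , N , far) = δ , 0<δ , N , λ n N≤n →
  subst (δ ℚ.≤_) (∣-∣-sym (seq x n) (seq y n)) (far n N≤n)

-- Beyond a common Cauchy index for `½ ℚ.* δ`, each sequence moves by less than `½ ℚ.* δ`, so the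
-- distance between the two drops by less than `δ`. One rational comparison at a late index thus
-- decides apartness.
far-stays-far : ∀ x y δ → 0ℚ ℚ.< δ → ∃[ N ] ∀ m n → N ℕ.≤ m → N ℕ.≤ n →
  δ ℚ.+ δ ℚ.≤ ℚ.∣ seq x m ℚ.- seq y m ∣ → δ ℚ.≤ ℚ.∣ seq x n ℚ.- seq y n ∣
far-stays-far x y δ 0<δ = Nˣ ℕ.⊔ Nʸ , λ m n N≤m N≤n far → ℚ.≮⇒≥ λ near →
  ℚ.<-irrefl refl (begin-strict
    δ ℚ.+ δ                     ≤⟨ far ⟩
    dist (xₛ m) (yₛ m)          ≤⟨ ∣-∣-triangle (xₛ m) (xₛ n) (yₛ m) ⟩
    dist (xₛ m) (xₛ n) ℚ.+ dist (xₛ n) (yₛ m)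
      ≤⟨ ℚ.+-monoʳ-≤ (dist (xₛ m) (xₛ n)) (∣-∣-triangle (xₛ n) (yₛ n) (yₛ m)) ⟩
    dist (xₛ m) (xₛ n) ℚ.+ (dist (xₛ n) (yₛ n) ℚ.+ dist (yₛ n) (yₛ m))
      <⟨ ℚ.+-mono-< (proj₂ closeˣ m n (ℕ.m⊔n≤o⇒m≤o Nˣ Nʸ N≤m) (ℕ.m⊔n≤o⇒m≤o Nˣ Nʸ N≤n))
           (ℚ.+-mono-< near
             (proj₂ closeʸ n m (ℕ.m⊔n≤o⇒n≤o Nˣ Nʸ N≤n) (ℕ.m⊔n≤o⇒n≤o Nˣ Nʸ N≤m))) ⟩
    η ℚ.+ (δ ℚ.+ η)             ≡⟨ solve 2 (λ a b → a :+ (b :+ a) := b :+ (a :+ a)) refl η δ ⟩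
    δ ℚ.+ (η ℚ.+ η)             ≡⟨ cong (δ ℚ.+_) (½+½ δ) ⟩
    δ ℚ.+ δ                     ∎)
  where
  open ℚ.≤-Reasoning
  open ℚ-Solver.+-*-Solver using (solve; _:+_; _:=_)
  dist : ℚ → ℚ → ℚ
  dist p q = ℚ.∣ p ℚ.- q ∣
  xₛ yₛ : ℕ → ℚ
  xₛ = seq x
  yₛ = seq y
  η = ½ ℚ.* δ
  closeˣ = cauchy x η (½-pos 0<δ)
  closeʸ = cauchy y η (½-pos 0<δ)
  Nˣ = proj₁ closeˣ
  Nʸ = proj₁ closeʸ

-- Constructive substitute for asking whether two reals are equal, which is undecidable: a single
-- late index `K` shows which of the two distances is large.
#-cotrans : ∀ x y z → x # y → x # z ⊎ z # y
#-cotrans x y z (γ , 0<γ , N , far) = go (δ ℚ.+ δ ℚ.≤? ℚ.∣ seq x K ℚ.- seq z K ∣)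
  where
  δ : ℚ
  -- A quarter of `γ`: if both distances at `K` were below `δ ℚ.+ δ`, the triangle inequality would
  -- put `x` and `y` closer than `γ`.
  δ = ½ ℚ.* (½ ℚ.* γ)
  0<δ = ½-pos (½-pos 0<γ)
  farˣᶻ = far-stays-far x z δ 0<δ
  farᶻʸ = far-stays-far z y δ 0<δ
  Nˣᶻ = proj₁ farˣᶻ
  Nᶻʸ = proj₁ farᶻʸ
  K = N ℕ.⊔ (Nˣᶻ ℕ.⊔ Nᶻʸ)
  Nˣᶻ≤K = ℕ.≤-trans (ℕ.m≤m⊔n Nˣᶻ Nᶻʸ) (ℕ.m≤n⊔m N (Nˣᶻ ℕ.⊔ Nᶻʸ))
  Nᶻʸ≤K = ℕ.≤-trans (ℕ.m≤n⊔m Nˣᶻ Nᶻʸ) (ℕ.m≤n⊔m N (Nˣᶻ ℕ.⊔ Nᶻʸ))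

  4δ≡γ : (δ ℚ.+ δ) ℚ.+ (δ ℚ.+ δ) ≡ γ
  4δ≡γ = trans (cong (λ t → t ℚ.+ t) (½+½ (½ ℚ.* γ))) (½+½ γ)

  go : Dec (δ ℚ.+ δ ℚ.≤ ℚ.∣ seq x K ℚ.- seq z K ∣) → x # z ⊎ z # y
  go (yes xz) = inj₁ (δ , 0<δ , Nˣᶻ , λ n Nˣᶻ≤n → proj₂ farˣᶻ K n Nˣᶻ≤K Nˣᶻ≤n xz)
  go (no ¬xz) = inj₂ (δ , 0<δ , Nᶻʸ , λ n Nᶻʸ≤n → proj₂ farᶻʸ K n Nᶻʸ≤K Nᶻʸ≤n
    (ℚ.≮⇒≥ λ zy → ℚ.<-irrefl refl (begin-strict
      γ                                                     ≤⟨ far K (ℕ.m≤m⊔n N _) ⟩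
      ℚ.∣ seq x K ℚ.- seq y K ∣                             ≤⟨ ∣-∣-triangle (seq x K) (seq z K) (seq y K) ⟩
      ℚ.∣ seq x K ℚ.- seq z K ∣ ℚ.+ ℚ.∣ seq z K ℚ.- seq y K ∣ <⟨ ℚ.+-mono-< (ℚ.≰⇒> ¬xz) zy ⟩
      (δ ℚ.+ δ) ℚ.+ (δ ℚ.+ δ)                               ≡⟨ 4δ≡γ ⟩
      γ                                                     ∎)))
    where open ℚ.≤-Reasoning

-- Termwise differences of sums of reals

-- Opaque because the conversion checker would unfold the operations of ℚ and ℝ.
opaque

  sum : List ℝ → ℝ
  sum = sumℝ

  difference : ℝ → ℝ → ℕ → ℚ
  difference x y n = seq x n ℚ.- seq y n

  infixl 6 _⊕_

  _⊕_ : ℝ → List ℝ → ℝ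
  x ⊕ xs = x +ℝ sumℝ xs

  ⊕≡+ℝ : ∀ x xs → x ⊕ xs ≡ x +ℝ sumℝ xs
  ⊕≡+ℝ x xs = refl

  #-respects-difference : ∀ {x y x′ y′} →
    (∀ n → difference x y n ≡ difference x′ y′ n) → x # y → x′ # y′
  #-respects-difference eq (δ , 0<δ , N , far) = δ , 0<δ , N , λ n N≤n →
    subst (λ t → δ ℚ.≤ ℚ.∣ t ∣) (eq n) (far n N≤n)

  difference-tail : ∀ x ys zs n →
    difference (sum (x ∷ ys)) (sum (x ∷ zs)) n ≡ difference (sum ys) (sum zs) n
  difference-tail x ys zs n = eq (seq x n) (seq (sumℝ ys) n) (seq (sumℝ zs) n)
    where
    open ℚ-Solver.+-*-Solver
    eq : ∀ p q r → (p ℚ.+ q) ℚ.- (p ℚ.+ r) ≡ q ℚ.- r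
    eq = solve 3 (λ p q r → (p :+ q) :- (p :+ r) := q :- r) refl

  difference-⊕ : ∀ x ys zs n → difference (x ⊕ ys) (x ⊕ zs) n ≡ difference (sum ys) (sum zs) n
  difference-⊕ = difference-tail

  difference-head : ∀ x y zs n →
    difference (sum (x ∷ zs)) (sum (y ∷ zs)) n ≡ difference x y n
  difference-head x y zs n = eq (seq x n) (seq y n) (seq (sumℝ zs) n)
    where
    open ℚ-Solver.+-*-Solver
    eq : ∀ p q r → (p ℚ.+ r) ℚ.- (q ℚ.+ r) ≡ p ℚ.- q
    eq = solve 3 (λ p q r → (p :+ r) :- (q :+ r) := p :- q) refl

  difference-transpose : ∀ x y x′ y′ n →
    difference x x′ n ≡ difference y y′ n → difference x y n ≡ difference x′ y′ n
  difference-transpose x y x′ y′ n = transpose (seq x n) (seq y n) (seq x′ n) (seq y′ n)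
    where
    open ℚ-Solver.+-*-Solver
    insert : ∀ p q s → p ℚ.- q ≡ (p ℚ.- s) ℚ.- (q ℚ.- s)
    insert = solve 3 (λ p q s → p :- q := (p :- s) :- (q :- s)) refl
    cancel : ∀ p r s → (p ℚ.- s) ℚ.- (p ℚ.- r) ≡ r ℚ.- s
    cancel = solve 3 (λ p r s → (p :- s) :- (p :- r) := r :- s) refl
    transpose : ∀ p q r s → p ℚ.- r ≡ q ℚ.- s → p ℚ.- q ≡ r ℚ.- s
    transpose p q r s eq = begin
      p ℚ.- q                       ≡⟨ insert p q s ⟩
      (p ℚ.- s) ℚ.- (q ℚ.- s)       ≡⟨ cong (λ t → (p ℚ.- s) ℚ.- t) (sym eq) ⟩
      (p ℚ.- s) ℚ.- (p ℚ.- r)       ≡⟨ cancel p r s ⟩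
      r ℚ.- s                       ∎
      where open ≡-Reasoning

-- Uniqueness makes `e` contribute exactly once; the contributions of all other entries agree and
-- cancel.
sum-change-one : ∀ {A : Set} (w w′ : A → ℝ) {e} {xs : List A} → Unique xs → e ∈ˡ xs →
  (∀ {f} → f ∈ˡ xs → f ≢ e → w f ≡ w′ f) → ∀ n →
  difference (sum (map w xs)) (sum (map w′ xs)) n ≡ difference (w e) (w′ e) n
sum-change-one w w′ {e} {e ∷ xs} (e∉xs ∷ _) (here refl) same n = begin
  difference (sum (w e ∷ map w xs)) (sum (w′ e ∷ map w′ xs)) n
    ≡⟨ cong (λ ws → difference (sum (w e ∷ ws)) (sum (w′ e ∷ map w′ xs)) n)
         (map-cong-local same′) ⟩
  difference (sum (w e ∷ map w′ xs)) (sum (w′ e ∷ map w′ xs)) n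
    ≡⟨ difference-head (w e) (w′ e) (map w′ xs) n ⟩
  difference (w e) (w′ e) n ∎
  where
  open ≡-Reasoning
  same′ : All (λ f → w f ≡ w′ f) xs
  same′ = All.tabulate λ f∈xs → same (there f∈xs) λ { refl → All.lookup e∉xs f∈xs refl }
sum-change-one w w′ {e} {x ∷ xs} (x∉xs ∷ uniq) (there e∈xs) same n = begin
  difference (sum (w x ∷ map w xs)) (sum (w′ x ∷ map w′ xs)) n
    ≡⟨ cong (λ r → difference (sum (r ∷ map w xs)) (sum (w′ x ∷ map w′ xs)) n)
         (same (here refl) (All.lookup x∉xs e∈xs)) ⟩
  difference (sum (w′ x ∷ map w xs)) (sum (w′ x ∷ map w′ xs)) n
    ≡⟨ difference-tail (w′ x) (map w xs) (map w′ xs) n ⟩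
  difference (sum (map w xs)) (sum (map w′ xs)) n
    ≡⟨ sum-change-one w w′ uniq e∈xs (same ∘ there) n ⟩
  difference (w e) (w′ e) n ∎
  where open ≡-Reasoning

-- Pigeonhole: conditions that each exclude at most one index

-- The hypothesis is the usable form of "at most one index fails", since `Q` need not be decidable.
-- By induction, index zero is compared with the exception of the tail: one of them satisfies `Q`,
-- and the other becomes the exception.
all-but-one : ∀ {k} (Q : Fin (suc k) → Set) → (∀ i j → i ≢ j → Q i ⊎ Q j) →
  ∃[ b ] (∀ i → i ≢ b → Q i)
all-but-one {zero} Q q = zero , λ { zero 0≢0 → contradiction refl 0≢0 }
all-but-one {suc k} Q q
  with b , rest ← all-but-one (Q ∘ suc) (λ i j i≢j → q (suc i) (suc j) (i≢j ∘ Fin.suc-injective))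
  with q zero (suc b) (λ ())
... | inj₁ q0 = suc b , λ { zero _ → q0 ; (suc i) i≢b → rest i (i≢b ∘ cong suc) }
... | inj₂ qb = zero , tail
  where
  tail : ∀ i → i ≢ zero → Q i
  tail zero 0≢0 = contradiction refl 0≢0
  tail (suc i) _ with i Fin.≟ b
  ... | yes refl = qb
  ... | no i≢b = rest i i≢b

-- Each condition removes one index, and `punchIn` reindexes those that remain; `k` conditions
-- cannot exhaust `suc k` indices.
pick : ∀ {C : Set} {k} (Q : C → Fin (suc k) → Set) (cs : List C) → length cs ℕ.≤ k →
  (∀ c i j → i ≢ j → Q c i ⊎ Q c j) → ∃[ i ] All (λ c → Q c i) cs
pick Q [] _ q = zero , []
pick Q (c ∷ cs) (s≤s len) q =
  let b , good = all-but-one (Q c) (q c)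
      i , goods = pick (λ c → Q c ∘ punchIn b) cs len λ c i j i≢j →
        q c (punchIn b i) (punchIn b j) (i≢j ∘ Fin.punchIn-injective b i j)
  in punchIn b i , good (punchIn b i) (Fin.punchInᵢ≢i b i) ∷ goods

-- Two-element sets

∣p∣≡0⇒∉ : ∀ {n} {p : Subset n} → ∣ p ∣ ≡ 0 → ∀ {t} → t ∉ p
∣p∣≡0⇒∉ {p = outside ∷ p} eq (there t∈p) = ∣p∣≡0⇒∉ eq t∈p

∣p∣≡1⇒singleton : ∀ {n} {p : Subset n} → ∣ p ∣ ≡ 1 → ∃[ y ] (y ∈ p × ∀ {t} → t ∈ p → t ≡ y)
∣p∣≡1⇒singleton {p = inside ∷ p} eq = zero , here , λ
  { here → refl
  ; (there t∈p) → contradiction t∈p (∣p∣≡0⇒∉ (ℕ.suc-injective eq)) }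
∣p∣≡1⇒singleton {p = outside ∷ p} eq =
  let y , y∈p , only = ∣p∣≡1⇒singleton eq
  in suc y , there y∈p , λ { (there t∈p) → cong suc (only t∈p) }

∣p∣≡2⇒other : ∀ {n} {p : Subset n} → ∣ p ∣ ≡ 2 → ∀ {x} → x ∈ p →
  ∃[ y ] (x ≢ y × y ∈ p × ∀ {t} → t ∈ p → t ≡ x ⊎ t ≡ y)
∣p∣≡2⇒other {p = inside ∷ p} eq here =
  let y , y∈p , only = ∣p∣≡1⇒singleton (ℕ.suc-injective eq)
  in suc y , (λ ()) , there y∈p , λ
    { here → inj₁ refl ; (there t∈p) → inj₂ (cong suc (only t∈p)) }
∣p∣≡2⇒other {p = inside ∷ p} eq (there x∈p) =
  let y , y∈p , only = ∣p∣≡1⇒singleton (ℕ.suc-injective eq)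
  in zero , (λ ()) , here , λ
    { here → inj₂ refl
    ; (there t∈p) → inj₁ (cong suc (trans (only t∈p) (sym (only x∈p)))) }
∣p∣≡2⇒other {p = outside ∷ p} eq (there x∈p) =
  let y , x≢y , y∈p , only = ∣p∣≡2⇒other eq x∈p
  in suc y , x≢y ∘ Fin.suc-injective , there y∈p , λ
    { (there t∈p) → Sum.map (cong suc) (cong suc) (only t∈p) }

∣p∣≡2⇒nonempty : ∀ {n} {p : Subset n} → ∣ p ∣ ≡ 2 → ∃[ x ] x ∈ p
∣p∣≡2⇒nonempty {p = inside ∷ p} eq = zero , here
∣p∣≡2⇒nonempty {p = outside ∷ p} eq =
  let x , x∈p = ∣p∣≡2⇒nonempty eq in suc x , there x∈p

-- Adjacent edges in a nice graph

module _ (G : Graph) where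

  open Graph G using (Adjacent; ends-size; ends-inj; edgesAt; degree; degreeIn)

  otherEnd : ∀ e {x} → x ∈ ends G e →
    ∃[ y ] (x ≢ y × y ∈ ends G e × ∀ {t} → t ∈ ends G e → t ≡ x ⊎ t ≡ y)
  otherEnd e = ∣p∣≡2⇒other (ends-size e)

  ends⊆ : ∀ {e f x y} → x ≢ y → x ∈ ends G e → y ∈ ends G e →
    x ∈ ends G f → y ∈ ends G f → ends G e ⊆ ends G f
  ends⊆ {e} x≢y x∈e y∈e x∈f y∈f t∈e with z , _ , _ , only ← otherEnd e x∈e
    with only y∈e
  ... | inj₁ y≡x = contradiction (sym y≡x) x≢y
  ... | inj₂ refl with only t∈e
  ...   | inj₁ refl = x∈f
  ...   | inj₂ refl = y∈f

  ends-determine : ∀ {e f x y} → x ≢ y → x ∈ ends G e → y ∈ ends G e →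
    x ∈ ends G f → y ∈ ends G f → e ≡ f
  ends-determine x≢y x∈e y∈e x∈f y∈f =
    ends-inj (⊆-antisym (ends⊆ x≢y x∈e y∈e x∈f y∈f) (ends⊆ x≢y x∈f y∈f x∈e y∈e))

  -- Adjacency in the line graph of `G`.
  Meets : E G → E G → Set
  Meets c e = c ≢ e × ∃[ z ] (z ∈ ends G c × z ∈ ends G e)

  meets? : ∀ c e → Dec (Meets c e)
  meets? c e = ¬? (c Fin.≟ e) ×-dec Fin.any? (λ z → (z ∈? ends G c) ×-dec (z ∈? ends G e))

  -- If `c` met no other edge, a walk starting at an end of `c` could only use `c`, so the ends of
  -- `c` would form a component isomorphic to `K₂`.
  nice⇒meets : Nice G → ∀ c → ∃[ e ] Meets c e
  nice⇒meets nice c with Fin.any? (meets? c)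
  ... | yes meets = meets
  ... | no isolated
    with x , x∈c ← ∣p∣≡2⇒nonempty (ends-size c)
    with y , x≢y , y∈c , only ← otherEnd c x∈c
    = contradiction (ends G c , (x , λ u → mk⇔ (reach u) (stay x∈c)) , iso) nice
    where
    stay : ∀ {u v} → u ∈ ends G c → Star Adjacent u v → v ∈ ends G c
    stay u∈c ε = u∈c
    stay {u} u∈c (_◅_ {j = v} (_ , e , u∈e , v∈e) path) with c Fin.≟ e
    ... | yes refl = stay v∈e path
    ... | no c≢e = contradiction (e , c≢e , u , u∈c , u∈e) isolated

    reach : ∀ u → u ∈ ends G c → Star Adjacent x u
    reach u u∈c with only u∈c
    ... | inj₁ refl = ε
    ... | inj₂ refl = (x≢y , c , x∈c , y∈c) ◅ ε

    to : V K₂ → V G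
    to zero = x
    to (suc zero) = y

    to∈c : ∀ i → to i ∈ ends G c
    to∈c zero = x∈c
    to∈c (suc zero) = y∈c

    to-injective : ∀ {i j} → to i ≡ to j → i ≡ j
    to-injective {zero} {zero} _ = refl
    to-injective {zero} {suc zero} eq = contradiction eq x≢y
    to-injective {suc zero} {zero} eq = contradiction (sym eq) x≢y
    to-injective {suc zero} {suc zero} _ = refl

    preimage : ∀ v → v ∈ ends G c → ∃[ i ] to i ≡ v
    preimage v v∈c with only v∈c
    ... | inj₁ refl = zero , refl
    ... | inj₂ refl = suc zero , refl

    iso : K₂ ≅ G [ ends G c ]
    iso = record
      { to = to
      ; injective = to-injective
      ; image = λ v → mk⇔ (preimage v) λ { (i , refl) → to∈c i }
      ; adjacent = λ i j → mk⇔
          (λ (i≢j , _) → i≢j ∘ to-injective , c , to∈c i , to∈c j)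
          (λ (to≢ , _) → to≢ ∘ cong to , zero , ∈⊤ , ∈⊤)
      }

  -- Weighting orders and the greedy choice

  -- A weighting order: when the head e is weighted, the edges of es are the
  -- unweighted ones, so e settles the edges meeting e but nothing in es.
  data Sparse (k : ℕ) : List (E G) → Set where
    []  : Sparse k []
    _∷_ : ∀ {e es} →
      ∃[ cs ] (length cs ℕ.≤ k × ∀ c → Meets c e → ¬ Any (Meets c) es → c ∈ˡ cs) →
      Sparse k es → Sparse k (e ∷ es)

  module Greedy {k} (wV : V G → ℝ) (LE : E G → RealList (suc k)) where

    Choice : Set
    Choice = E G → Fin (suc k)

    weight : Choice → E G → ℝ
    weight ι e = entry (LE e) (ι e)

    colour : Choice → V G → ℝ
    colour ι v = wV v ⊕ map (weight ι) (edgesAt v)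

    Separates : Choice → E G → Set
    Separates ι c = ∀ {x y} → x ≢ y → x ∈ ends G c → y ∈ ends G c → colour ι x # colour ι y

    colour-unchanged : ∀ {ι ι′ x} → (∀ f → x ∈ ends G f → ι f ≡ ι′ f) → colour ι x ≡ colour ι′ x
    colour-unchanged {x = x} same = cong (wV x ⊕_)
      (map-cong-local {xs = edgesAt x} (All.tabulate λ {f} f∈ →
        cong (entry (LE f)) (same f (proj₂ (∈-filter⁻ (λ e → x ∈? ends G e) {xs = allFin (#E G)} f∈)))))

    colour-change-one : ∀ {ι ι′ x e} → x ∈ ends G e →
      (∀ f → x ∈ ends G f → f ≢ e → ι f ≡ ι′ f) → ∀ n →
      difference (colour ι x) (colour ι′ x) n ≡ difference (weight ι e) (weight ι′ e) n
    colour-change-one {ι} {ι′} {x} {e} x∈e same n = trans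
      (difference-⊕ (wV x) (map (weight ι) (edgesAt x)) (map (weight ι′) (edgesAt x)) n)
      (sum-change-one (weight ι) (weight ι′)
        (Unique.filter⁺ at? (Unique.allFin⁺ (#E G)))
        (∈-filter⁺ at? (∈-allFin e) x∈e)
        (λ {f} f∈ f≢e → cong (entry (LE f)) (same f (proj₂ (∈-filter⁻ at? {xs = allFin (#E G)} f∈)) f≢e)) n)
      where
      at? = λ e → x ∈? ends G e

    -- Both colours change by the change of the weight of c itself.
    separates-stable : ∀ {ι ι′ c} → (∀ f → Meets c f → ι f ≡ ι′ f) →
      Separates ι c → Separates ι′ c
    separates-stable {ι} {ι′} {c} same sep {x} {y} x≢y x∈c y∈c =
      #-respects-difference
        (λ n → difference-transpose (colour ι x) (colour ι y) (colour ι′ x) (colour ι′ y) n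
          (trans (shift x∈c n) (sym (shift y∈c n))))
        (sep x≢y x∈c y∈c)
      where
      shift : ∀ {v} → v ∈ ends G c → ∀ n →
        difference (colour ι v) (colour ι′ v) n ≡ difference (weight ι c) (weight ι′ c) n
      shift {v} v∈c = colour-change-one v∈c λ f v∈f f≢c → same f (≢-sym f≢c , v , v∈c , v∈f)

    colour≡total : ∀ ι v → colour ι v ≡ total G wV (weight ι) v
    colour≡total ι v = ⊕≡+ℝ (wV v) (map (weight ι) (edgesAt v))

    set : Choice → E G → Fin (suc k) → Choice
    set ι e i = updateAt ι e (const i)

    set-other : ∀ {ι e i} f → f ≢ e → set ι e i f ≡ ι f
    set-other {ι} {e} f = updateAt-minimal f e ι

    -- Let `x` be a common end of `c` and `e`, and `y` the other end of `c`. Passing from `i` to `j`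
    -- moves the colour of `x` to one apart from it but keeps that of `y`, since `e` containing `y`
    -- would equal `c`. By cotransitivity the colour of `y` is apart from one of the two colours of
    -- `x`.
    separates-one-of-two : ∀ ι {c e} → Meets c e → ∀ {i j} → i ≢ j →
      Separates (set ι e i) c ⊎ Separates (set ι e j) c
    separates-one-of-two ι {c} {e} (c≢e , x , x∈c , x∈e) {i} {j} i≢j
      with y , x≢y , y∈c , only ← otherEnd c x∈c =
      Sum.map (extend {set ι e i})
        (λ y#xʲ → extend {set ι e j} (subst (xʲ #_) yⁱ≡yʲ (#-sym yⁱ xʲ y#xʲ)))
        (#-cotrans (colour (set ι e i) x) xʲ yⁱ xⁱ#xʲ)
      where
      xʲ = colour (set ι e j) x
      yⁱ = colour (set ι e i) y

      set-agree : ∀ f → f ≢ e → set ι e i f ≡ set ι e j f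
      set-agree f f≢e = trans (set-other f f≢e) (sym (set-other f f≢e))

      yⁱ≡yʲ : yⁱ ≡ colour (set ι e j) y
      yⁱ≡yʲ = colour-unchanged λ f y∈f → set-agree f
        λ { refl → c≢e (ends-determine x≢y x∈c y∈c x∈e y∈f) }

      weight-set : ∀ i → weight (set ι e i) e ≡ entry (LE e) i
      weight-set i = cong (entry (LE e)) (updateAt-updates e ι)

      xⁱ#xʲ : colour (set ι e i) x # xʲ
      xⁱ#xʲ = #-respects-difference
        (λ n → sym (trans (colour-change-one x∈e (λ f _ → set-agree f) n)
          (cong₂ (λ r s → difference r s n) (weight-set i) (weight-set j))))
        (distinct (LE e) i j i≢j)

      extend : ∀ {ι} → colour ι x # colour ι y → Separates ι c
      extend {ι} x#y u≢v u∈c v∈c with only u∈c | only v∈c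
      ... | inj₁ refl | inj₁ refl = contradiction refl u≢v
      ... | inj₁ refl | inj₂ refl = x#y
      ... | inj₂ refl | inj₁ refl = #-sym (colour ι x) (colour ι y) x#y
      ... | inj₂ refl | inj₂ refl = contradiction refl u≢v

    -- The list of candidates for `e` may contain edges that do not meet `e`. The condition is
    -- vacuous for them, so `pick` can treat all candidates alike.
    separates-if-meets : ∀ ι e c i j → i ≢ j →
      (Meets c e → Separates (set ι e i) c) ⊎ (Meets c e → Separates (set ι e j) c)
    separates-if-meets ι e c i j i≢j with meets? c e
    ... | yes meets = Sum.map const const (separates-one-of-two ι meets i≢j)
    ... | no ¬meets = inj₁ λ meets → contradiction meets ¬meets

    -- That edges outside `es` keep their weight is what protects earlier work: an edge settled by
    -- `e` meets nothing in the remaining list, so later choices cannot undo its separation.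
    greedy : ∀ {es} → Sparse k es → ∀ ι →
      ∃[ ι′ ] ((∀ f → f ∉ˡ es → ι f ≡ ι′ f) × (∀ c → Any (Meets c) es → Separates ι′ c))
    greedy [] ι = ι , (λ _ _ → refl) , λ _ ()
    greedy {e ∷ es} ((cs , len , covers) ∷ sparse) ι
      with i , good ← pick (λ c i → Meets c e → Separates (set ι e i) c) cs len
        (separates-if-meets ι e)
      with ι′ , same , separated ← greedy sparse (set ι e i)
      = ι′
      , (λ f f∉ → trans (sym (set-other f (f∉ ∘ here))) (same f (f∉ ∘ there)))
      , settle
      where
      settle : ∀ c → Any (Meets c) (e ∷ es) → Separates ι′ c
      settle c meets with Any.any? (meets? c) es
      ... | yes later = separated c later
      ... | no ¬later = separates-stable
        (λ f c-f → same f λ f∈es → ¬later (lose f∈es c-f))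
        (All.lookup good (covers c meets-e ¬later) meets-e)
        where
        meets-e : Meets c e
        meets-e = Any.head ¬later meets

    separates⇒proper : ∀ ι → (∀ c → Separates ι c) → ProperColouring G (total G wV (weight ι))
    separates⇒proper ι separated u v (u≢v , c , u∈c , v∈c) =
      subst₂ _#_ {colour ι u} {total G wV (weight ι) u} {colour ι v} {total G wV (weight ι) v}
        (colour≡total ι u) (colour≡total ι v) (separated c {u} {v} u≢v u∈c v∈c)

    properChoice : ∀ {es} → Sparse k es → (∀ c → Any (Meets c) es) →
      ∃[ ι ] ProperColouring G (total G wV (weight ι))
    properChoice sparse meets =
      -- The starting choice is an arbitrary default: `greedy` separates every edge that meets some
      -- entry of `es`, whatever it starts from.
      let ι , _ , separated = greedy sparse (const zero)
      in ι , separates⇒proper ι (λ c → separated c (meets c))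

  -- An order in which each edge settles at most `Δ G + d` edges

  degree≤Δ : ∀ v → degree v ℕ.≤ Δ G
  degree≤Δ v = All.lookup (xs≤max 0 (map degree (allFin (#V G)))) (∈-map⁺ degree (∈-allFin v))

  module Peeling {d} (degenerate : Degenerate d G) where

    in? : ∀ S v e → Dec (v ∈ ends G e × ends G e ⊆ S)
    in? S v e = (v ∈? ends G e) ×-dec (ends G e ⊆? S)

    edgesIn : Subset (#V G) → V G → List (E G)
    edgesIn S v = filter (in? S v) (allFin (#E G))

    module _ {S v} (small : degreeIn S v ℕ.≤ d) {rest} (outside∈rest : ∀ e → ¬ (ends G e ⊆ S) → e ∈ˡ rest) where

      -- The alternative 'yes' is that of v having a later neighbour.
      settled-at-v : ∀ {e} → e ∈ˡ edgesIn S v →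
        ∃[ cs ] (length cs ℕ.≤ d × ∀ c → v ∈ ends G c → ¬ Any (Meets c) rest → c ∈ˡ cs)
      settled-at-v e∈ with Any.any? (λ f → v ∈? ends G f) rest
      -- The singleton has length at most `d` because `e` itself lies in `edgesIn S v`, which forces
      -- `d` to be positive.
      ... | yes later with f , f∈rest , v∈f ← find later = [ f ] , ℕ.≤-trans (∈-length e∈) small , λ c v∈c ¬meets →
        here (decidable-stable (c Fin.≟ f) λ c≢f →
          ¬meets (lose f∈rest (c≢f , v , v∈c , v∈f)))
      ... | no ¬later = edgesIn S v , small , λ c v∈c _ →
        ∈-filter⁺ (in? S v) (∈-allFin c) (v∈c ,
          decidable-stable (ends G c ⊆? S) λ c⊈S → ¬later (lose (outside∈rest c c⊈S) v∈c))

      -- A settled edge meets `e` at `u` or at `v`. The bound at `v` uses only `rest`, not the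
      -- remaining edges `es` of the block, so the edges of the block may come in any order.
      sparse-++ : Sparse (Δ G + d) rest → ∀ es → All (_∈ˡ edgesIn S v) es →
        Sparse (Δ G + d) (es ++ rest)
      sparse-++ sparse [] [] = sparse
      sparse-++ sparse (e ∷ es) (e∈ ∷ es∈)
        with _ , v∈e , _ ← ∈-filter⁻ (in? S v) {xs = allFin (#E G)} e∈
        with u , _ , _ , only ← otherEnd e v∈e
        with cs , len , covers ← settled-at-v e∈
        = ( edgesAt u ++ cs
          , subst (ℕ._≤ Δ G + d) (sym (length-++ (edgesAt u))) (ℕ.+-mono-≤ (degree≤Δ u) len)
          , settled ) ∷ sparse-++ sparse es es∈
        where
        settled : ∀ c → Meets c e → ¬ Any (Meets c) (es ++ rest) → c ∈ˡ edgesAt u ++ cs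
        settled c (_ , z , z∈c , z∈e) ¬later with only z∈e
        ... | inj₁ refl = ∈-++⁺ʳ (edgesAt u) (covers c z∈c (¬later ∘ Any.++⁺ʳ es))
        ... | inj₂ refl = ∈-++⁺ˡ (∈-filter⁺ (λ e → z ∈? ends G e) (∈-allFin c) z∈c)

    -- The order is built from its end: a vertex `v` of small degree in `S` is the last vertex of
    -- `S`, so its edges inside `S` go directly before `rest`, which contains all edges leaving `S`.
    peel : ∀ {S} → Acc _⊂_ S → ∀ {rest} → (∀ e → ¬ (ends G e ⊆ S) → e ∈ˡ rest) →
      Sparse (Δ G + d) rest → ∃[ es ] (Sparse (Δ G + d) es × ∀ e → e ∈ˡ es)
    peel {S} (acc smaller) {rest} outside∈rest sparse with nonempty? S
    ... | no empty = rest , sparse , λ e →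
      let x , x∈e = ∣p∣≡2⇒nonempty (ends-size e)
      in outside∈rest e λ e⊆S → empty (x , e⊆S x∈e)
    ... | yes nonempty with v , v∈S , small ← degenerate S nonempty =
      peel (smaller (x∈p⇒p-x⊂p v∈S)) outside∈block++rest
        (sparse-++ small outside∈rest sparse (edgesIn S v) (All.tabulate λ e∈ → e∈))
      where
      outside∈block++rest : ∀ e → ¬ (ends G e ⊆ S - v) → e ∈ˡ edgesIn S v ++ rest
      outside∈block++rest e e⊈S-v with ends G e ⊆? S | v ∈? ends G e
      ... | no e⊈S | _ = ∈-++⁺ʳ (edgesIn S v) (outside∈rest e e⊈S)
      ... | yes e⊆S | yes v∈e = ∈-++⁺ˡ (∈-filter⁺ (in? S v) (∈-allFin e) (v∈e , e⊆S))
      ... | yes e⊆S | no v∉e = ⊥-elim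
        (e⊈S-v λ t∈e → x∈p∧x≢y⇒x∈p-y (e⊆S t∈e) λ { refl → v∉e t∈e })

    sparseOrder : ∃[ es ] (Sparse (Δ G + d) es × ∀ e → e ∈ˡ es)
    sparseOrder = peel (⊂-wellFounded ⊤) (λ e e⊈⊤ → ⊥-elim (e⊈⊤ λ _ → ∈⊤)) []

  -- Weight choosability of nice graphs

  nice⇒weightChoosable : Nice G → ∀ d → Degenerate d G → WeightChoosable G 1 (suc (Δ G + d))
  nice⇒weightChoosable nice d degenerate LV LE =
    let es , sparse , all∈es = Peeling.sparseOrder degenerate
        wV = λ v → entry (LV v) zero
        ι , proper = Greedy.properChoice wV LE sparse
          -- Niceness gives `c` an adjacent edge `f`, and the order contains every edge, so each `c`
          -- is settled at some point.
          (λ c → let f , c-f = nice⇒meets nice c in lose (all∈es f) c-f)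
    in wV , (λ e → entry (LE e) (ι e))
      , (λ v → zero , ≃-refl {wV v})
      , (λ e → ι e , ≃-refl {entry (LE e) (ι e)})
      , proper

corollary4p4 : (G : Graph) → Nice G →
    ((d : ℕ) → Degenerate d G → WeightChoosable G 1 (Δ G + d + 1))
    × WeightChoosable G 1 (Δ G + col G)
corollary4p4 G nice =
  -- The second part is the first with `d` the degeneracy; as `col G` is `degeneracy G + 1`, only
  -- the sum has to be reassociated.
  choosable , subst (WeightChoosable G 1) (ℕ.+-assoc (Δ G) (degeneracy G) 1)
    (choosable (degeneracy G) (proj₁ (proj₂ (leastDegenerate G))))
  where
  choosable : ∀ d → Degenerate d G → WeightChoosable G 1 (Δ G + d + 1)
  choosable d degenerate = subst (WeightChoosable G 1) (ℕ.+-comm 1 (Δ G + d))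
    (nice⇒weightChoosable G nice d degenerate)
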